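{- Let $G=(V,E)$ be a connected locally finite graph. If $\mathrm{DN}_{\mathrm{LLY}}(G)<\infty$, then either $G=C_n$ (the cycle of length $n$) for some $n\ge 6$, or the tree-like skeleton $\mathcal S(G)$ is a forest.
   Context: Graphs are simple and undirected; $G$ may be infinite but is locally finite. Let $d(\cdot,\cdot)$ be the combinatorial graph distance. For a positive edge weight $w:E\to(0,\infty)$ put $d_x^w:=\sum_{y\sim x}w_{xy}$. For $\alpha\in[0,1]$ let $\mu_x^{\alpha,w}$ be the probability measure with $\mu_x^{\alpha,w}(x)=\alpha$, $\mu_x^{\alpha,w}(z)=(1-\alpha)w_{xz}/d_x^w$ for $z\sim x$, and $0$ otherwise. Let $W_1$ be the $1$-Wasserstein distance with respect to $d$. For $x\sim y$ let $\kappa_\alpha^w(x,y):=1-W_1(\mu_x^{\alpha,w},\mu_y^{\alpha,w})$ and define the weighted Lin--Lu--Yau curvature $\kappa_{\mathrm{LLY}}^w(x,y):=\lim_{\alpha\to1^- }\kappa_\alpha^w(x,y)/(1-\alpha)$. For connected locally finite $G$ with $E\neq\varnothing$: $\mathrm{Dist}(w):=\sup_{e\in E}w_e/\inf_{e\in E}w_e$, with value $+\infty$ if the supremum is infinite or the infimum is $0$; a positive weight $w$ is admissible if $\kappa_{\mathrm{LLY}}^w(e)\ge0$ for every $e\in E$; and $\mathrm{DN}_{\mathrm{LLY}}(G):=\inf\{\mathrm{Dist}(w): w \text{ admissible}\}$, with value $+\infty$ if no admissible weight has finite distortion. By convention $\mathrm{DN}_{\mathrm{LLY}}(K_1)=1$.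 An edge is tree-like in $G$ if it lies on no cycle of $G$ of length $3$, $4$ or $5$; $E_{\mathrm{tl}}(G)$ is the set of tree-like edges, and the tree-like skeleton is $\mathcal S(G):=(V,E_{\mathrm{tl}}(G))$. -}

module Defs where

open import Level using (0ℓ) renaming (suc to lsuc)
open import Algebra.Bundles using (CommutativeRing)
import Algebra.Definitions.RawMonoid as RawMonoidDefinitions
open import Algebra.Properties.Ring using (-‿involutive)
open import Axiom.ExcludedMiddle using (ExcludedMiddle)
open import Data.Empty using (⊥-elim)
open import Data.Fin.Base using (Fin; toℕ)
open import Data.List.Base using (List; []; _∷_; map; foldr)
open import Data.List.Membership.Propositional using (_∈_)
open import Data.List.Relation.Unary.All as All using ()
open import Data.List.Relation.Unary.Any using (here; there)
open import Data.List.Relation.Unary.Unique.Propositional using (Unique)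
open import Data.List.Relation.Unary.AllPairs using (_∷_)
open import Data.Nat.Base as ℕ using (ℕ; zero; suc; s≤s; z≤n)
open import Data.Product.Base using (Σ; ∃; ∃₂; _×_; _,_; proj₁; proj₂)
open import Data.Sum.Base using (_⊎_; inj₁; inj₂; swap)
open import Function.Base using (_∘_)
open import Function.Bundles using (_⇔_; _↔_; Equivalence; Inverse)
open import Function.Definitions using (Injective)
open import Relation.Binary.Core using (Rel)
open import Relation.Binary.Definitions using (Symmetric)
open import Relation.Binary.PropositionalEquality as ≡ using (_≡_)
import Relation.Binary.Construct.Add.Supremum.Equality as AddSupremumEquality
import Relation.Binary.Construct.Add.Supremum.Strict as AddSupremumStrict
import Relation.Binary.Construct.NonStrictToStrict as ToStrict
import Relation.Binary.Reasoning.Setoid as SetoidReasoning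
open import Relation.Binary.Structures using (IsTotalOrder)
open import Relation.Nullary using (¬_; yes; no)
open import Relation.Nullary.Construct.Add.Supremum using (_⁺; [_]; ⊤⁺)

------------------------------------------------------------------------
-- Real numbers

module Bounds {A : Set} (_≤_ : Rel A 0ℓ) where

  UpperBound LowerBound : (A → Set) → A → Set
  UpperBound P u = ∀ x → P x → x ≤ u
  LowerBound P l = ∀ x → P x → l ≤ x

  IsSupremum IsInfimum : (A → Set) → A → Set
  IsSupremum P s = UpperBound P s × (∀ u → UpperBound P u → s ≤ u)
  IsInfimum  P i = LowerBound P i × (∀ l → LowerBound P l → l ≤ i)

-- ℝ is axiomatised as a Dedekind-complete totally ordered field, which
-- determines it up to isomorphism in classical logic.  Equality is a setoid
-- equality, so that constructions by Cauchy sequences or cuts are models.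
record CompleteOrderedField : Set (lsuc 0ℓ) where
  infix 4 _≤_ _<_
  infix 8 _⁻¹
  field
    commutativeRing : CommutativeRing 0ℓ 0ℓ

  open CommutativeRing commutativeRing public

  field
    _≤_          : Rel Carrier 0ℓ
    isTotalOrder : IsTotalOrder _≈_ _≤_
    0≉1          : ¬ (0# ≈ 1#)
    -- The inverse is a total operation with unspecified value at 0#.
    _⁻¹          : Carrier → Carrier
    *-inverseʳ   : ∀ x → ¬ (x ≈ 0#) → x * x ⁻¹ ≈ 1#
    +-monoˡ-≤    : ∀ z {x y} → x ≤ y → x + z ≤ y + z
    *-nonneg     : ∀ {x y} → 0# ≤ x → 0# ≤ y → 0# ≤ x * y

  open Bounds _≤_ public

  field
    supremum : (P : Carrier → Set) → ∃ P → ∃ (UpperBound P) → ∃ (IsSupremum P)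

  module ≤ = IsTotalOrder isTotalOrder

  _<_ : Rel Carrier 0ℓ
  _<_ = ToStrict._<_ _≈_ _≤_

  infimum : (P : Carrier → Set) → ∃ P → ∃ (LowerBound P) → ∃ (IsInfimum P)
  infimum P (x , px) lb =
    let i , above , least = supremum (LowerBound P) lb (x , λ l l≤P → l≤P x px)
    in i , (λ y py → least y λ l l≤P → l≤P y py) , above

  fromℕ : ℕ → Carrier
  fromℕ n = n ×ᵣ 1#
    where open RawMonoidDefinitions +-rawMonoid renaming (_×_ to _×ᵣ_)

  ∑ : {A : Set} → List A → (A → Carrier) → Carrier
  ∑ xs f = foldr _+_ 0# (map f xs)

  syntax ∑ xs (λ x → e) = ∑[ x ∈ xs ] e

------------------------------------------------------------------------
-- Elementary facts about ordered fields and finite sums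

module FieldLemmas (ℝ : CompleteOrderedField) where
  open CompleteOrderedField ℝ

  ≤-resp₂ : ∀ {x x′ y y′} → x ≈ x′ → y ≈ y′ → x ≤ y → x′ ≤ y′
  ≤-resp₂ p q r = ≤.trans (≤.reflexive (sym p)) (≤.trans r (≤.reflexive q))

  +-mono-≤ : ∀ {x y u v} → x ≤ y → u ≤ v → x + u ≤ y + v
  +-mono-≤ {x} {y} {u} {v} p q =
    ≤.trans (+-monoˡ-≤ u p) (≤-resp₂ (+-comm u y) (+-comm v y) (+-monoˡ-≤ y q))

  +-nonneg : ∀ {x y} → 0# ≤ x → 0# ≤ y → 0# ≤ x + y
  +-nonneg p q = ≤-resp₂ (+-identityˡ 0#) refl (+-mono-≤ p q)

  x≤y⇒0≤y-x : ∀ {x y} → x ≤ y → 0# ≤ y - x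
  x≤y⇒0≤y-x {x} p = ≤-resp₂ (-‿inverseʳ x) refl (+-monoˡ-≤ (- x) p)

  0≤1 : 0# ≤ 1#
  0≤1 with ≤.total 0# 1#
  ... | inj₁ p = p
  ... | inj₂ p = ≤-resp₂ refl -1*-1≈1 (*-nonneg 0≤-1 0≤-1)
    where
    open import Algebra.Properties.Ring ring using (-1*x≈-x)
    0≤-1 : 0# ≤ - 1#
    0≤-1 = ≤-resp₂ refl (+-identityˡ (- 1#)) (x≤y⇒0≤y-x p)
    -1*-1≈1 : - 1# * - 1# ≈ 1#
    -1*-1≈1 = trans (-1*x≈-x (- 1#)) (-‿involutive ring 1#)

  ⁻¹-nonneg : ∀ {x} → ¬ (x ≈ 0#) → 0# ≤ x → 0# ≤ x ⁻¹
  ⁻¹-nonneg {x} x≉0 0≤x with ≤.total 0# (x ⁻¹)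
  ... | inj₁ p = p
  ... | inj₂ p = ⊥-elim (0≉1 (≤.antisym 0≤1 1≤0))
    where
    open import Algebra.Properties.Ring ring using (-‿distribʳ-*)
    0≤-1 : 0# ≤ - 1#
    0≤-1 = ≤-resp₂ refl
      (trans (sym (-‿distribʳ-* x (x ⁻¹))) (-‿cong (*-inverseʳ x x≉0)))
      (*-nonneg 0≤x (≤-resp₂ refl (+-identityˡ _) (x≤y⇒0≤y-x p)))
    1≤0 : 1# ≤ 0#
    1≤0 = ≤-resp₂ (+-identityˡ 1#) (-‿inverseˡ 1#) (+-monoˡ-≤ 1# 0≤-1)

  fromℕ-nonneg : ∀ n → 0# ≤ fromℕ n
  fromℕ-nonneg zero    = ≤.refl
  fromℕ-nonneg (suc n) = +-nonneg 0≤1 (fromℕ-nonneg n)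

  module _ {A : Set} where

    ∑-cong : ∀ (xs : List A) {f g} → (∀ x → x ∈ xs → f x ≈ g x) → ∑ xs f ≈ ∑ xs g
    ∑-cong []       p = refl
    ∑-cong (x ∷ xs) p = +-cong (p x (here ≡.refl)) (∑-cong xs λ y → p y ∘ there)

    ∑-*ˡ : ∀ c (xs : List A) f → (∑[ x ∈ xs ] (c * f x)) ≈ c * ∑ xs f
    ∑-*ˡ c []       f = sym (zeroʳ c)
    ∑-*ˡ c (x ∷ xs) f = trans (+-congˡ (∑-*ˡ c xs f)) (sym (distribˡ c (f x) (∑ xs f)))

    ∑-nonneg : ∀ (xs : List A) {f} → (∀ x → x ∈ xs → 0# ≤ f x) → 0# ≤ ∑ xs f
    ∑-nonneg []       p = ≤.refl
    ∑-nonneg (x ∷ xs) p = +-nonneg (p x (here ≡.refl)) (∑-nonneg xs λ y → p y ∘ there)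

    term≤∑ : ∀ (xs : List A) {f} → (∀ x → x ∈ xs → 0# ≤ f x) → ∀ {x} → x ∈ xs → f x ≤ ∑ xs f
    term≤∑ (x ∷ xs) {f} p (here ≡.refl) =
      ≤-resp₂ (+-identityʳ (f x)) refl
        (+-mono-≤ ≤.refl (∑-nonneg xs λ y → p y ∘ there))
    term≤∑ (x ∷ xs) p (there q) =
      ≤-resp₂ (+-identityˡ _) refl
        (+-mono-≤ (p x (here ≡.refl)) (term≤∑ xs (λ y → p y ∘ there) q))

------------------------------------------------------------------------
-- Graphs

record SimpleGraph : Set (lsuc 0ℓ) where
  infix 4 _∼_
  field
    V        : Set
    _∼_      : Rel V 0ℓ
    ∼-sym    : Symmetric _∼_
    ∼-irrefl : ∀ {x} → ¬ (x ∼ x)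

LocallyFinite : SimpleGraph → Set
LocallyFinite G = ∀ x → Σ (List V) λ nbrs → Unique nbrs × (∀ z → z ∈ nbrs ⇔ x ∼ z)
  where open SimpleGraph G

module _ (G : SimpleGraph) where
  open SimpleGraph G

  data Walk : V → V → ℕ → Set where
    nil  : ∀ {x} → Walk x x 0
    cons : ∀ {x y z n} → x ∼ y → Walk y z n → Walk x z (suc n)

Connected : SimpleGraph → Set
Connected G = ∀ x y → ∃ (Walk G x y)
  where open SimpleGraph G

infix 4 _≅_
_≅_ : SimpleGraph → SimpleGraph → Set
G ≅ H = Σ (G.V ↔ H.V) λ φ → ∀ x y → x G.∼ y ⇔ Inverse.to φ x H.∼ Inverse.to φ y
  where
  module G = SimpleGraph G
  module H = SimpleGraph H

CyclicSuccessor : ∀ {n} → Fin n → Fin n → Set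
CyclicSuccessor {n} i j = suc (toℕ i) ≡ toℕ j ⊎ (suc (toℕ i) ≡ n × toℕ j ≡ 0)

C : ∀ n → 3 ℕ.≤ n → SimpleGraph
C n 3≤n = record
  { V        = Fin n
  ; _∼_      = λ i j → CyclicSuccessor i j ⊎ CyclicSuccessor j i
  ; ∼-sym    = swap
  ; ∼-irrefl = λ { (inj₁ p) → irrefl 3≤n p ; (inj₂ p) → irrefl 3≤n p }
  }
  where
  m≢1+m : ∀ {m} → ¬ (suc m ≡ m)
  m≢1+m ()

  irrefl : ∀ {n} → 3 ℕ.≤ n → {i : Fin n} → ¬ CyclicSuccessor i i
  irrefl _   (inj₁ p)       = m≢1+m p
  irrefl (s≤s (s≤s (s≤s _))) {i} (inj₂ (p , q)) with toℕ i
  irrefl (s≤s (s≤s (s≤s _))) {i} (inj₂ (() , ≡.refl)) | .0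

-- A cycle of length n in G is an injective homomorphism from Cₙ to G.
record Cycle (G : SimpleGraph) (n : ℕ) : Set where
  open SimpleGraph G
  field
    3≤n       : 3 ℕ.≤ n
    vertex    : Fin n → V
    injective : Injective _≡_ _≡_ vertex
    adjacent  : ∀ {i j} → SimpleGraph._∼_ (C n 3≤n) i j → vertex i ∼ vertex j

  Contains : V → V → Set
  Contains x y = ∃₂ λ i j →
    SimpleGraph._∼_ (C n 3≤n) i j × vertex i ≡ x × vertex j ≡ y

IsForest : SimpleGraph → Set
IsForest G = ∀ n → ¬ Cycle G n

module _ (G : SimpleGraph) where
  open SimpleGraph G

  TreeLike : V → V → Set
  TreeLike x y = ∀ n → n ≡ 3 ⊎ n ≡ 4 ⊎ n ≡ 5 → (c : Cycle G n) → ¬ Cycle.Contains c x y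

  𝒮 : SimpleGraph
  𝒮 = record
    { V        = V
    ; _∼_      = λ x y → x ∼ y × TreeLike x y
    ; ∼-sym    = λ (p , t) → ∼-sym p , λ n n∈ c (i , j , q , a , b) →
                   t n n∈ c (j , i , swap q , b , a)
    ; ∼-irrefl = λ (p , _) → ∼-irrefl p
    }

------------------------------------------------------------------------
-- Wasserstein distance, curvature and distortion

-- Excluded middle is used to make the (classical) definitions by cases.
module Curvature
  (em : ExcludedMiddle 0ℓ) (ℝ : CompleteOrderedField)
  (G : SimpleGraph) (locallyFinite : LocallyFinite G) (connected : Connected G)
  where

  open SimpleGraph G
  open CompleteOrderedField ℝ
  open FieldLemmas ℝ
  open AddSupremumEquality _≈_ using (_≈⁺_)
  open AddSupremumStrict _<_ using (_<⁺_)

  leastℕ : (P : ℕ → Set) → ∀ n → P n → ∃ λ n → P n × (∀ m → P m → n ℕ.≤ m)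
  leastℕ P zero    p = 0 , p , λ _ _ → z≤n
  leastℕ P (suc n) p with em {P 0}
  ... | yes p₀ = 0 , p₀ , λ _ _ → z≤n
  ... | no ¬p₀ =
    let k , pk , least = leastℕ (P ∘ suc) n p in
    suc k , pk , λ { zero q → ⊥-elim (¬p₀ q) ; (suc m) q → s≤s (least m q) }

  d : V → V → ℕ
  d x y = let n , p = connected x y in proj₁ (leastℕ (Walk G x y) n p)

  -- Finitely supported probability measures; masses inside `support` may
  -- vanish.
  record Probability : Set where
    field
      mass     : V → Carrier
      support  : List V
      unique   : Unique support
      nonneg   : ∀ z → 0# ≤ mass z
      vanishes : ∀ z → ¬ (z ∈ support) → mass z ≈ 0#
      total    : ∑ support mass ≈ 1#

  open Probability using (mass; support)

  record Coupling (μ ν : Probability) : Set where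
    field
      plan      : V → V → Carrier
      nonneg    : ∀ z z′ → 0# ≤ plan z z′
      vanishes  : ∀ z z′ → ¬ (z ∈ support μ × z′ ∈ support ν) → plan z z′ ≈ 0#
      marginalˡ : ∀ z → (∑[ z′ ∈ support ν ] plan z z′) ≈ mass μ z
      marginalʳ : ∀ z′ → (∑[ z ∈ support μ ] plan z z′) ≈ mass ν z′

    cost : Carrier
    cost = ∑[ z ∈ support μ ] ∑[ z′ ∈ support ν ] (fromℕ (d z z′) * plan z z′)

  TransportCost : Probability → Probability → Carrier → Set
  TransportCost μ ν r = Σ (Coupling μ ν) λ π → Coupling.cost π ≈ r

  productCoupling : ∀ μ ν → Coupling μ ν
  productCoupling μ ν = record
    { plan      = λ z z′ → mass μ z * mass ν z′
    ; nonneg    = λ z z′ → *-nonneg (μ.nonneg z) (ν.nonneg z′)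
    ; vanishes  = vanishes
    ; marginalˡ = λ z → begin
        (∑[ z′ ∈ support ν ] (mass μ z * mass ν z′)) ≈⟨ ∑-*ˡ (mass μ z) (support ν) (mass ν) ⟩
        mass μ z * ∑ (support ν) (mass ν)          ≈⟨ *-congˡ ν.total ⟩
        mass μ z * 1#                              ≈⟨ *-identityʳ _ ⟩
        mass μ z                                   ∎
    ; marginalʳ = λ z′ → begin
        (∑[ z ∈ support μ ] (mass μ z * mass ν z′)) ≈⟨ ∑-cong (support μ) (λ z _ → *-comm _ _) ⟩
        (∑[ z ∈ support μ ] (mass ν z′ * mass μ z)) ≈⟨ ∑-*ˡ (mass ν z′) (support μ) (mass μ) ⟩
        mass ν z′ * ∑ (support μ) (mass μ)        ≈⟨ *-congˡ μ.total ⟩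
        mass ν z′ * 1#                            ≈⟨ *-identityʳ _ ⟩
        mass ν z′                                 ∎
    }
    where
    open SetoidReasoning setoid
    module μ = Probability μ
    module ν = Probability ν
    vanishes : ∀ z z′ → ¬ (z ∈ support μ × z′ ∈ support ν) → mass μ z * mass ν z′ ≈ 0#
    vanishes z z′ ¬p with em {z ∈ support μ}
    ... | no z∉  = trans (*-congʳ (μ.vanishes z z∉)) (zeroˡ _)
    ... | yes z∈ = trans (*-congˡ (ν.vanishes z′ λ z′∈ → ¬p (z∈ , z′∈))) (zeroʳ _)

  transportCost-nonneg : ∀ μ ν → LowerBound (TransportCost μ ν) 0#
  transportCost-nonneg μ ν r (π , c≈r) = ≤-resp₂ refl c≈r
    (∑-nonneg (support μ) λ z _ → ∑-nonneg (support ν) λ z′ _ →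
      *-nonneg (fromℕ-nonneg (d z z′)) (Coupling.nonneg π z z′))

  W₁-infimum : ∀ μ ν → ∃ (IsInfimum (TransportCost μ ν))
  W₁-infimum μ ν = infimum (TransportCost μ ν)
    (_ , productCoupling μ ν , refl) (0# , transportCost-nonneg μ ν)

  W₁ : Probability → Probability → Carrier
  W₁ μ ν = proj₁ (W₁-infimum μ ν)

  neighbours : V → List V
  neighbours x = proj₁ (locallyFinite x)

  -- Only the values at adjacent pairs are meaningful.
  record Weight : Set where
    field
      weight    : V → V → Carrier
      symmetric : ∀ {x y} → x ∼ y → weight x y ≈ weight y x
      positive  : ∀ {x y} → x ∼ y → 0# < weight x y

  module _ (w : Weight) where
    open Weight w

    degree : V → Carrier
    degree x = ∑[ y ∈ neighbours x ] weight x y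

    private
      ∈⇒∼ : ∀ {x z} → z ∈ neighbours x → x ∼ z
      ∈⇒∼ {x} {z} = Equivalence.to (proj₂ (proj₂ (locallyFinite x)) z)

      ∼⇒∈ : ∀ {x z} → x ∼ z → z ∈ neighbours x
      ∼⇒∈ {x} {z} = Equivalence.from (proj₂ (proj₂ (locallyFinite x)) z)

    degree-positive : ∀ {x y} → x ∼ y → 0# < degree x
    degree-positive {x} {y} x∼y = ≤.trans 0≤w w≤d , λ 0≈d →
      w≉0 (≤.antisym 0≤w (≤-resp₂ refl (sym 0≈d) w≤d))
      where
      0≤w = proj₁ (positive x∼y)
      w≉0 = proj₂ (positive x∼y)
      w≤d : weight x y ≤ degree x
      w≤d = term≤∑ (neighbours x) (λ z → proj₁ ∘ positive ∘ ∈⇒∼) (∼⇒∈ x∼y)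

    μ-mass : Carrier → V → V → Carrier
    μ-mass α x z with em {z ≡ x} | em {x ∼ z}
    ... | yes _ | _     = α
    ... | no _  | yes _ = (1# - α) * (weight x z * degree x ⁻¹)
    ... | no _  | no _  = 0#

    -- x must not be isolated; here y witnesses this.
    μ : ∀ {α} → 0# ≤ α → α ≤ 1# → ∀ {x y} → x ∼ y → Probability
    μ {α} 0≤α α≤1 {x} {y} x∼y = record
      { mass     = μ-mass α x
      ; support  = x ∷ neighbours x
      ; unique   = All.tabulate (λ z∈ x≡z → x≢nbr z∈ (≡.sym x≡z)) ∷ proj₁ (proj₂ (locallyFinite x))
      ; nonneg   = nonneg
      ; vanishes = vanishes
      ; total    = begin
          μ-mass α x x + ∑ (neighbours x) (μ-mass α x)
            ≈⟨ +-cong at-x (∑-cong (neighbours x) λ z → at-nbr) ⟩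
          α + (∑[ z ∈ neighbours x ] ((1# - α) * (degree x ⁻¹ * weight x z)))
            ≈⟨ +-congˡ (trans (∑-*ˡ (1# - α) (neighbours x) _)
                 (*-congˡ (∑-*ˡ (degree x ⁻¹) (neighbours x) (weight x)))) ⟩
          α + (1# - α) * (degree x ⁻¹ * degree x)
            ≈⟨ +-congˡ (*-congˡ (trans (*-comm _ _) (*-inverseʳ _ d≉0))) ⟩
          α + (1# - α) * 1#
            ≈⟨ +-congˡ (*-identityʳ _) ⟩
          α + (1# - α)
            ≈⟨ +-comm _ _ ⟩
          (1# - α) + α
            ≈⟨ +-assoc _ _ _ ⟩
          1# + (- α + α)
            ≈⟨ +-congˡ (-‿inverseˡ α) ⟩
          1# + 0#
            ≈⟨ +-identityʳ _ ⟩
          1# ∎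
      }
      where
      open SetoidReasoning setoid

      x≢nbr : ∀ {z} → z ∈ neighbours x → ¬ (z ≡ x)
      x≢nbr z∈ ≡.refl = ∼-irrefl (∈⇒∼ z∈)

      d≉0 : ¬ (degree x ≈ 0#)
      d≉0 = proj₂ (degree-positive x∼y) ∘ sym

      0≤d⁻¹ : 0# ≤ degree x ⁻¹
      0≤d⁻¹ = ⁻¹-nonneg d≉0 (proj₁ (degree-positive x∼y))

      nonneg : ∀ z → 0# ≤ μ-mass α x z
      nonneg z with em {z ≡ x} | em {x ∼ z}
      ... | yes _ | _     = 0≤α
      ... | no _  | yes p = *-nonneg (x≤y⇒0≤y-x α≤1) (*-nonneg (proj₁ (positive p)) 0≤d⁻¹)
      ... | no _  | no _  = ≤.refl

      vanishes : ∀ z → ¬ (z ∈ x ∷ neighbours x) → μ-mass α x z ≈ 0#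
      vanishes z z∉ with em {z ≡ x} | em {x ∼ z}
      ... | yes p | _     = ⊥-elim (z∉ (here p))
      ... | no _  | yes p = ⊥-elim (z∉ (there (∼⇒∈ p)))
      ... | no _  | no _  = refl

      at-x : μ-mass α x x ≈ α
      at-x with em {x ≡ x} | em {x ∼ x}
      ... | yes _ | _ = refl
      ... | no ¬p | _ = ⊥-elim (¬p ≡.refl)

      at-nbr : ∀ {z} → z ∈ neighbours x →
               μ-mass α x z ≈ (1# - α) * (degree x ⁻¹ * weight x z)
      at-nbr {z} z∈ with em {z ≡ x} | em {x ∼ z}
      ... | yes p | _     = ⊥-elim (x≢nbr z∈ p)
      ... | no _  | yes _ = *-congˡ (*-comm _ _)
      ... | no _  | no ¬p = ⊥-elim (¬p (∈⇒∼ z∈))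

    κ : ∀ {α} → 0# ≤ α → α ≤ 1# → ∀ {x y} → x ∼ y → Carrier
    κ 0≤α α≤1 x∼y = 1# - W₁ (μ 0≤α α≤1 x∼y) (μ 0≤α α≤1 (∼-sym x∼y))

    -- IsκLLY x∼y L: κ_α(x,y) / (1 - α) → L as α → 1⁻.
    IsκLLY : ∀ {x y} → x ∼ y → Carrier → Set
    IsκLLY x∼y L =
      ∀ ε → 0# < ε → ∃ λ δ → 0# < δ ×
      (∀ α (0≤α : 0# ≤ α) (α<1 : α < 1#) → 1# - δ < α →
       let q = κ 0≤α (proj₁ α<1) x∼y * (1# - α) ⁻¹
       in L - ε < q × q < L + ε)

    Admissible : Set
    Admissible = ∀ {x y} (x∼y : x ∼ y) → ∃ λ L → IsκLLY x∼y L × 0# ≤ L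

    EdgeValue : Carrier → Set
    EdgeValue r = ∃₂ λ x y → x ∼ y × weight x y ≈ r

  HasEdge : Set
  HasEdge = ∃₂ _∼_

  module _ (hasEdge : HasEdge) where

    module _ (w : Weight) where
      open Weight w

      private
        someValue : ∃ (EdgeValue w)
        someValue = let x , y , x∼y = hasEdge in weight x y , x , y , x∼y , refl

        values-nonneg : LowerBound (EdgeValue w) 0#
        values-nonneg r (x , y , x∼y , p) = ≤-resp₂ refl p (proj₁ (positive x∼y))

      supWeight : ∃ (UpperBound (EdgeValue w)) → ∃ (IsSupremum (EdgeValue w))
      supWeight = supremum (EdgeValue w) someValue

      infWeight : ∃ (IsInfimum (EdgeValue w))
      infWeight = infimum (EdgeValue w) someValue (0# , values-nonneg)

      Dist : Carrier ⁺
      Dist with em {∃ (UpperBound (EdgeValue w))} | em {proj₁ infWeight ≈ 0#}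
      ... | yes bdd | no _  = [ proj₁ (supWeight bdd) * proj₁ infWeight ⁻¹ ]
      ... | yes _   | yes _ = ⊤⁺
      ... | no _    | _     = ⊤⁺

      Dist-nonneg : ∀ {r} → Dist ≈⁺ [ r ] → 0# ≤ r
      Dist-nonneg p with em {∃ (UpperBound (EdgeValue w))} | em {proj₁ infWeight ≈ 0#}
      Dist-nonneg AddSupremumEquality.[ p ] | yes bdd | no i≉0 =
        ≤-resp₂ refl p (*-nonneg 0≤s (⁻¹-nonneg i≉0 0≤i))
        where
        0≤i = proj₂ (proj₂ infWeight) 0# values-nonneg
        0≤s = ≤.trans (values-nonneg _ (proj₂ someValue))
                (proj₁ (proj₂ (supWeight bdd)) _ (proj₂ someValue))
      Dist-nonneg () | yes _ | yes _
      Dist-nonneg () | no _  | _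

    FiniteDistortion : Carrier → Set
    FiniteDistortion r = Σ Weight λ w → Admissible w × Dist w ≈⁺ [ r ]

    infDist : ∃ FiniteDistortion → ∃ (IsInfimum FiniteDistortion)
    infDist nonempty = infimum FiniteDistortion nonempty
      (0# , λ r (w , _ , p) → Dist-nonneg w p)

  -- A connected graph without edges is K₁ (or empty).
  DN-LLY : Carrier ⁺
  DN-LLY with em {HasEdge}
  ... | no _ = [ 1# ]
  ... | yes e with em {∃ (FiniteDistortion e)}
  ...   | yes nonempty = [ proj₁ (infDist e nonempty) ]
  ...   | no _         = ⊤⁺

  Finite : Carrier ⁺ → Set
  Finite r = r <⁺ ⊤⁺

{-# OPTIONS --safe #-}
module Submission where

-- Write r(x,y) = w_xy / d_x, so that the values r(x,z) over the neighbours z of x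
-- sum to 1.  Testing the transport problem for a tree-like edge xy against a
-- 1-Lipschitz potential gives κ(x,y) ≤ 2 (r(x,y) + r(y,x)) - 2, so admissibility
-- yields r(x,y) + r(y,x) ≥ 1.  Along a cycle u_0, u_1, … of tree-like edges put
-- s_i = r(u_i, u_{i+1}) and t_i = r(u_{i+1}, u_i); then
-- s_{i+1} + t_i ≤ 1 ≤ s_i + t_i, so s is antitone, and being periodic it is
-- constant.  Hence s_{i+1} + t_i = 1, which leaves no weight for a third
-- neighbour of u_{i+1}, and by connectedness the cycle is all of G.

open import Defs
open import Level using (0ℓ)
import Algebra.Properties.Monoid.Mult as MonoidMult
import Algebra.Solver.Ring.NaturalCoefficients.Default as NaturalCoefficients
open import Axiom.ExcludedMiddle using (ExcludedMiddle)
open import Data.Empty using (⊥; ⊥-elim)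
open import Data.Fin.Base using (Fin; zero; suc; toℕ)
open import Data.Fin.Properties using (toℕ-injective; toℕ<n; toℕ-fromℕ<)
open import Data.List.Base using (List; []; _∷_; lookup; length)
open import Data.List.Membership.Propositional using (_∈_)
open import Data.List.Membership.Propositional.Properties using (∈-lookup)
open import Data.List.Relation.Unary.All as All using (All; []; _∷_)
open import Data.List.Relation.Unary.All.Properties using (─⁺)
open import Data.List.Relation.Unary.AllPairs using ([]; _∷_)
open import Data.List.Relation.Unary.Any using (here; there; _─_)
open import Data.List.Relation.Unary.Unique.Propositional using (Unique)
open import Data.Nat.Base as ℕ using (ℕ; zero; suc; s≤s; z≤n)
open import Data.Nat.DivMod
  using (_%_; _mod_; %-distribˡ-+; m<n⇒m%n≡m; n%n≡0; [m+n]%n≡m%n; m%n<n; m%n%n≡m%n)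
import Data.Nat.Properties as ℕₚ
open import Data.Product.Base using (Σ; ∃; ∃₂; _×_; _,_; proj₁; proj₂)
open import Data.Sum.Base using (_⊎_; inj₁; inj₂)
open import Function.Base using (_∘_)
open import Function.Bundles using (Equivalence; mk⇔; mk↔ₛ′)
open import Relation.Binary.Bundles using (Poset)
open import Relation.Binary.PropositionalEquality as ≡ using (_≡_; _≢_)
import Relation.Binary.Reasoning.PartialOrder as PartialOrderReasoning
import Relation.Binary.Reasoning.Setoid as SetoidReasoning
open import Relation.Nullary using (¬_; yes; no)

-- Duplicate-free lists.

lookup-injective : {A : Set} {xs : List A} → Unique xs →
                   ∀ {i j} → lookup xs i ≡ lookup xs j → i ≡ j
lookup-injective (_ ∷ _) {zero}  {zero}  _ = ≡.refl
lookup-injective (p ∷ _) {zero}  {suc j} e = ⊥-elim (All.lookup p (∈-lookup j) e)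
lookup-injective (p ∷ _) {suc i} {zero}  e = ⊥-elim (All.lookup p (∈-lookup i) (≡.sym e))
lookup-injective (_ ∷ u) {suc i} {suc j} e = ≡.cong suc (lookup-injective u e)

∈-─ : {A : Set} {x y : A} {xs : List A} (p : x ∈ xs) → y ∈ xs → y ≢ x → y ∈ (xs ─ p)
∈-─ (here ≡.refl) (here q)  y≢x = ⊥-elim (y≢x q)
∈-─ (here _)      (there q) _   = q
∈-─ (there _)     (here q)  _   = here q
∈-─ (there p)     (there q) y≢x = there (∈-─ p q y≢x)

-- Ordered-field arithmetic and finite sums.

module OrderedField (ℝ : CompleteOrderedField) where
  open CompleteOrderedField ℝ
  open FieldLemmas ℝ
  open NaturalCoefficients commutativeSemiring using (solve; _:+_; _:*_; _:=_; con)

  poset : Poset 0ℓ 0ℓ 0ℓ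
  poset = record { isPartialOrder = ≤.isPartialOrder }

  module ≤-Reasoning = PartialOrderReasoning poset

  x-y+y≈x : ∀ x y → x - y + y ≈ x
  x-y+y≈x x y = trans (+-assoc x (- y) y) (trans (+-congˡ (-‿inverseˡ y)) (+-identityʳ x))

  +-cancelʳ-≤ : ∀ {x y} z → x + z ≤ y + z → x ≤ y
  +-cancelʳ-≤ {x} {y} z p = ≤-resp₂ (lem x) (lem y) (+-monoˡ-≤ (- z) p)
    where
    lem : ∀ u → u + z - z ≈ u
    lem u = trans (+-assoc u z (- z)) (trans (+-congˡ (-‿inverseʳ z)) (+-identityʳ u))

  ≤⇒≯ : ∀ {x y} → x ≤ y → ¬ (y < x)
  ≤⇒≯ p (q , y≉x) = y≉x (≤.antisym q p)

  +-monoˡ-< : ∀ z {x y} → x < y → x + z < y + z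
  +-monoˡ-< z {x} {y} (p , x≉y) = +-monoˡ-≤ z p , λ e →
    x≉y (≤.antisym p (+-cancelʳ-≤ z (≤.reflexive (sym e))))

  <-resp₂ : ∀ {x x′ y y′} → x ≈ x′ → y ≈ y′ → x < y → x′ < y′
  <-resp₂ p q (r , x≉y) = ≤-resp₂ p q r , λ e → x≉y (trans p (trans e (sym q)))

  *-monoˡ-≤ : ∀ {x y z} → 0# ≤ z → x ≤ y → x * z ≤ y * z
  *-monoˡ-≤ {x} {y} {z} 0≤z x≤y =
    ≤-resp₂ (+-identityˡ (x * z)) (trans (sym (distribʳ z (y - x) x)) (*-congʳ (x-y+y≈x y x)))
      (+-monoˡ-≤ (x * z) (*-nonneg (x≤y⇒0≤y-x x≤y) 0≤z))

  *-positive : ∀ {x y} → 0# < x → 0# < y → 0# < x * y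
  *-positive {x} {y} (0≤x , 0≉x) (0≤y , 0≉y) = *-nonneg 0≤x 0≤y , λ 0≈xy →
    0≉x (begin
      0#               ≈⟨ zeroˡ _ ⟨
      0# * y ⁻¹        ≈⟨ *-congʳ 0≈xy ⟩
      x * y * y ⁻¹     ≈⟨ *-assoc x y _ ⟩
      x * (y * y ⁻¹)   ≈⟨ *-congˡ (*-inverseʳ y (0≉y ∘ sym)) ⟩
      x * 1#           ≈⟨ *-identityʳ x ⟩
      x                ∎)
    where open SetoidReasoning setoid

  ⁻¹-positive : ∀ {x} → 0# < x → 0# < x ⁻¹
  ⁻¹-positive {x} (0≤x , 0≉x) = ⁻¹-nonneg (0≉x ∘ sym) 0≤x , λ 0≈x⁻¹ →
    0≉1 (trans (sym (zeroʳ x)) (trans (*-congˡ 0≈x⁻¹) (*-inverseʳ x (0≉x ∘ sym))))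

  x<y⇒0<y-x : ∀ {x y} → x < y → 0# < y - x
  x<y⇒0<y-x {x} p = <-resp₂ (-‿inverseʳ x) refl (+-monoˡ-< (- x) p)

  fromℕ-+ : ∀ m n → fromℕ (m ℕ.+ n) ≈ fromℕ m + fromℕ n
  fromℕ-+ = MonoidMult.×-homo-+ +-monoid 1#

  fromℕ-mono-≤ : ∀ {m n} → m ℕ.≤ n → fromℕ m ≤ fromℕ n
  fromℕ-mono-≤ {n = n} z≤n = fromℕ-nonneg n
  fromℕ-mono-≤ (s≤s p)     = +-mono-≤ ≤.refl (fromℕ-mono-≤ p)

  -- The witness is α = (1 + δ)⁻¹, for which 1 - α = α δ.
  approach-1 : ∀ {δ} → 0# < δ → ∃ λ α → 0# ≤ α × α < 1# × 1# - δ < α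
  approach-1 {δ} 0<δ@(0≤δ , 0≉δ) = α , proj₁ 0<α , α<1 , 1-δ<α
    where
    1+δ>0 : 0# < 1# + δ
    1+δ>0 = +-nonneg 0≤1 0≤δ , λ e → 0≉1 (≤.antisym 0≤1
      (≤-resp₂ (+-identityʳ 1#) (sym e) (+-mono-≤ ≤.refl 0≤δ)))
    α = (1# + δ) ⁻¹
    0<α = ⁻¹-positive 1+δ>0
    αδ+α≈1 : α * δ + α ≈ 1#
    αδ+α≈1 = trans (solve 2 (λ a d → a :* d :+ a := (con 1 :+ d) :* a) refl α δ)
      (*-inverseʳ (1# + δ) (proj₂ 1+δ>0 ∘ sym))
    α<1 : α < 1#
    α<1 = <-resp₂ (+-identityˡ α) αδ+α≈1 (+-monoˡ-< α (*-positive 0<α 0<δ))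
    1-δ<α : 1# - δ < α
    1-δ<α = <-resp₂ (+-congʳ αδ+α≈1) (x+y-x≈y δ α) (+-monoˡ-< (- δ) (+-monoˡ-< α αδ<δ))
      where
      αδ<δ : α * δ < δ
      αδ<δ = <-resp₂ (+-identityˡ _)
        (trans (sym (distribʳ δ (1# - α) α)) (trans (*-congʳ (x-y+y≈x 1# α)) (*-identityˡ δ)))
        (+-monoˡ-< (α * δ) (*-positive (x<y⇒0<y-x α<1) 0<δ))
      x+y-x≈y : ∀ x y → x + y - x ≈ y
      x+y-x≈y x y = trans (+-congʳ (+-comm x y))
        (trans (+-assoc y x (- x)) (trans (+-congˡ (-‿inverseʳ x)) (+-identityʳ y)))

  module _ {A : Set} where

    ∑-0 : ∀ (xs : List A) → ∑ xs (λ _ → 0#) ≈ 0#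
    ∑-0 []       = refl
    ∑-0 (_ ∷ xs) = trans (+-identityˡ _) (∑-0 xs)

    ∑-+ : ∀ (xs : List A) f g → ∑ xs (λ x → f x + g x) ≈ ∑ xs f + ∑ xs g
    ∑-+ []       f g = sym (+-identityˡ 0#)
    ∑-+ (x ∷ xs) f g = trans (+-congˡ (∑-+ xs f g))
      (solve 4 (λ a b c d → a :+ b :+ (c :+ d) := a :+ c :+ (b :+ d)) refl _ _ _ _)

    ∑-mono : ∀ (xs : List A) {f g} → (∀ x → x ∈ xs → f x ≤ g x) → ∑ xs f ≤ ∑ xs g
    ∑-mono []       p = ≤.refl
    ∑-mono (x ∷ xs) p = +-mono-≤ (p x (here ≡.refl)) (∑-mono xs λ y → p y ∘ there)

    ∑-─ : ∀ {x} {xs : List A} (p : x ∈ xs) f → ∑ xs f ≈ f x + ∑ (xs ─ p) f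
    ∑-─ (here ≡.refl) f = refl
    ∑-─ (there p)     f = trans (+-congˡ (∑-─ p f))
      (solve 3 (λ a b c → a :+ (b :+ c) := b :+ (a :+ c)) refl _ _ _)

    -- Each entry of `ys` is matched with an occurrence in `xs`, which is then deleted. Uniqueness
    -- of `ys` keeps the later entries available after the deletion, and the terms left over at the
    -- end are nonnegative.
    ∑-⊆ : ∀ (ys : List A) {xs f} → Unique ys → (∀ {y} → y ∈ ys → y ∈ xs) →
          All (λ x → 0# ≤ f x) xs → ∑ ys f ≤ ∑ xs f
    ∑-⊆ []       _       _  f≥0 = ∑-nonneg _ λ _ → All.lookup f≥0
    ∑-⊆ (y ∷ ys) (y∉ ∷ u) ys⊆xs f≥0 = ≤.trans
      (+-mono-≤ ≤.refl (∑-⊆ ys u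
        (λ z∈ → ∈-─ y∈ (ys⊆xs (there z∈)) (All.lookup y∉ z∈ ∘ ≡.sym)) (─⁺ y∈ f≥0)))
      (≤.reflexive (sym (∑-─ y∈ _)))
      where y∈ = ys⊆xs (here ≡.refl)

    -- The two sums differ only at `x`. The terms there are moved across instead of subtracted, so
    -- the commutative-semiring solver suffices.
    ∑-update : ∀ {x} {xs : List A} {f g} → Unique xs → x ∈ xs →
               (∀ y → y ∈ xs → y ≢ x → f y ≈ g y) → ∑ xs f + g x ≈ ∑ xs g + f x
    ∑-update {f = f} {g} (x∉ ∷ _) (here {xs = xs} ≡.refl) f≈g =
      trans (+-congʳ (+-congˡ (∑-cong xs λ y y∈ →
              f≈g y (there y∈) (All.lookup x∉ y∈ ∘ ≡.sym))))
        (solve 3 (λ a b c → a :+ b :+ c := c :+ b :+ a) refl _ _ _)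
    ∑-update (z∉ ∷ u) (there x∈) f≈g =
      trans (+-assoc _ _ _) (trans
        (+-cong (f≈g _ (here ≡.refl) (All.lookup z∉ x∈))
          (∑-update u x∈ λ y y∈ → f≈g y (there y∈)))
        (sym (+-assoc _ _ _)))

  ∑-swap : {A B : Set} (xs : List A) (ys : List B) (f : A → B → Carrier) →
           ∑ xs (λ x → ∑ ys (f x)) ≈ ∑ ys (λ y → ∑ xs (λ x → f x y))
  ∑-swap []       ys f = sym (∑-0 ys)
  ∑-swap (x ∷ xs) ys f = trans (+-congˡ (∑-swap xs ys f)) (sym (∑-+ ys (f x) _))

-- Short cycles

successor-unique : ∀ {n} {i j k : Fin n} → CyclicSuccessor i j → CyclicSuccessor i k → j ≡ k
successor-unique (inj₁ p)       (inj₁ q)       = toℕ-injective (≡.trans (≡.sym p) q)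
successor-unique (inj₁ p)       (inj₂ (q , _)) = ⊥-elim (ℕₚ.<⇒≢ (toℕ<n _) (≡.trans (≡.sym p) q))
successor-unique (inj₂ (p , _)) (inj₁ q)       = ⊥-elim (ℕₚ.<⇒≢ (toℕ<n _) (≡.trans (≡.sym q) p))
successor-unique (inj₂ (_ , p)) (inj₂ (_ , q)) = toℕ-injective (≡.trans p (≡.sym q))

module ShortCycles (em : ExcludedMiddle 0ℓ) (G : SimpleGraph) where
  open SimpleGraph G

  ∼⇒≢ : ∀ {x y} → x ∼ y → x ≢ y
  ∼⇒≢ p ≡.refl = ∼-irrefl p

  -- It is enough to exhibit one successor for each position: `successor-unique` carries the
  -- adjacency to every pair that `CyclicSuccessor` relates.
  cycleThrough : (xs : List V) → 3 ℕ.≤ length xs → Unique xs →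
                 (∀ i → ∃ λ j → CyclicSuccessor i j × lookup xs i ∼ lookup xs j) →
                 Cycle G (length xs)
  cycleThrough xs 3≤n u next = record
    { 3≤n       = 3≤n
    ; vertex    = lookup xs
    ; injective = lookup-injective u
    ; adjacent  = λ { (inj₁ p) → adj p ; (inj₂ p) → ∼-sym (adj p) }
    }
    where
    adj : ∀ {i j} → CyclicSuccessor i j → lookup xs i ∼ lookup xs j
    adj {i} p with next i
    ... | k , q , e with successor-unique p q
    ... | ≡.refl = e

  module TreeLikeEdge {x y} (x∼y : x ∼ y) (treeLike : TreeLike G x y) where

    no-triangle : ∀ {z} → y ∼ z → z ∼ x → ⊥
    no-triangle {z} y∼z z∼x =
      treeLike 3 (inj₁ ≡.refl) cycle (zero , suc zero , inj₁ (inj₁ ≡.refl) , ≡.refl , ≡.refl)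
      where
      cycle : Cycle G 3
      cycle = cycleThrough (x ∷ y ∷ z ∷ []) (s≤s (s≤s (s≤s z≤n)))
        ((∼⇒≢ x∼y ∷ ∼⇒≢ z∼x ∘ ≡.sym ∷ []) ∷ (∼⇒≢ y∼z ∷ []) ∷ [] ∷ [])
        λ { zero             → suc zero       , inj₁ ≡.refl            , x∼y
          ; (suc zero)       → suc (suc zero) , inj₁ ≡.refl            , y∼z
          ; (suc (suc zero)) → zero           , inj₂ (≡.refl , ≡.refl) , z∼x }

    no-square : ∀ {z t} → y ∼ z → z ∼ t → t ∼ x → z ≢ x → t ≢ y → ⊥
    no-square {z} {t} y∼z z∼t t∼x z≢x t≢y =
      treeLike 4 (inj₂ (inj₁ ≡.refl)) cycle
        (zero , suc zero , inj₁ (inj₁ ≡.refl) , ≡.refl , ≡.refl)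
      where
      cycle : Cycle G 4
      cycle = cycleThrough (x ∷ y ∷ z ∷ t ∷ []) (s≤s (s≤s (s≤s z≤n)))
        ( (∼⇒≢ x∼y ∷ z≢x ∘ ≡.sym ∷ ∼⇒≢ t∼x ∘ ≡.sym ∷ [])
        ∷ (∼⇒≢ y∼z ∷ t≢y ∘ ≡.sym ∷ []) ∷ (∼⇒≢ z∼t ∷ []) ∷ [] ∷ [])
        λ { zero                   → suc zero             , inj₁ ≡.refl            , x∼y
          ; (suc zero)             → suc (suc zero)       , inj₁ ≡.refl            , y∼z
          ; (suc (suc zero))       → suc (suc (suc zero)) , inj₁ ≡.refl            , z∼t
          ; (suc (suc (suc zero))) → zero                 , inj₂ (≡.refl , ≡.refl) , t∼x }

    -- Consecutive vertices differ because they are adjacent, and two further pairs differ by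
    -- hypothesis. Each of the three remaining coincidences, `x` with `m`, `y` with `m` and `z` with
    -- `t`, would already close a triangle on the edge.
    no-pentagon : ∀ {z m t} → y ∼ z → z ∼ m → m ∼ t → t ∼ x → z ≢ x → t ≢ y → ⊥
    no-pentagon {z} {m} {t} y∼z z∼m m∼t t∼x z≢x t≢y =
      treeLike 5 (inj₂ (inj₂ ≡.refl)) cycle
        (zero , suc zero , inj₁ (inj₁ ≡.refl) , ≡.refl , ≡.refl)
      where
      x≢m : x ≢ m
      x≢m ≡.refl = no-triangle y∼z z∼m
      y≢m : y ≢ m
      y≢m ≡.refl = no-triangle m∼t t∼x
      z≢t : z ≢ t
      z≢t ≡.refl = no-triangle y∼z t∼x
      cycle : Cycle G 5
      cycle = cycleThrough (x ∷ y ∷ z ∷ m ∷ t ∷ []) (s≤s (s≤s (s≤s z≤n)))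
        ( (∼⇒≢ x∼y ∷ z≢x ∘ ≡.sym ∷ x≢m ∷ ∼⇒≢ t∼x ∘ ≡.sym ∷ [])
        ∷ (∼⇒≢ y∼z ∷ y≢m ∷ t≢y ∘ ≡.sym ∷ []) ∷ (∼⇒≢ z∼m ∷ z≢t ∷ []) ∷ (∼⇒≢ m∼t ∷ []) ∷ [] ∷ [])
        λ { zero                         → suc zero                   , inj₁ ≡.refl            , x∼y
          ; (suc zero)                   → suc (suc zero)             , inj₁ ≡.refl            , y∼z
          ; (suc (suc zero))             → suc (suc (suc zero))       , inj₁ ≡.refl            , z∼m
          ; (suc (suc (suc zero)))       → suc (suc (suc (suc zero))) , inj₁ ≡.refl            , m∼t
          ; (suc (suc (suc (suc zero)))) → zero                       , inj₂ (≡.refl , ≡.refl) , t∼x }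

    -- Absence of short cycles makes this 1-Lipschitz from the unit ball of x to that of y.
    potential : V → ℕ
    potential z with em {z ≡ x} | em {z ≡ y} | em {x ∼ z}
    ... | yes _ | _     | _     = 2
    ... | no _  | yes _ | _     = 1
    ... | no _  | no _  | yes _ = 3
    ... | no _  | no _  | no _  = 0

    potential-x : potential x ≡ 2
    potential-x with em {x ≡ x} | em {x ≡ y} | em {x ∼ x}
    ... | yes _ | _ | _ = ≡.refl
    ... | no ¬p | _ | _ = ⊥-elim (¬p ≡.refl)

    potential-y : potential y ≡ 1
    potential-y with em {y ≡ x} | em {y ≡ y} | em {x ∼ y}
    ... | yes p | _     | _ = ⊥-elim (∼⇒≢ x∼y (≡.sym p))
    ... | no _  | yes _ | _ = ≡.refl
    ... | no _  | no ¬p | _ = ⊥-elim (¬p ≡.refl)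

    potential-near-x : ∀ {z} → x ∼ z → z ≢ y → potential z ≡ 3
    potential-near-x {z} x∼z z≢y with em {z ≡ x} | em {z ≡ y} | em {x ∼ z}
    ... | yes p | _     | _     = ⊥-elim (∼⇒≢ x∼z (≡.sym p))
    ... | no _  | yes p | _     = ⊥-elim (z≢y p)
    ... | no _  | no _  | yes _ = ≡.refl
    ... | no _  | no _  | no ¬p = ⊥-elim (¬p x∼z)

    potential-near-y : ∀ {z} → y ∼ z → z ≢ x → potential z ≡ 0
    potential-near-y {z} y∼z z≢x with em {z ≡ x} | em {z ≡ y} | em {x ∼ z}
    ... | yes p | _     | _     = ⊥-elim (z≢x p)
    ... | no _  | yes p | _     = ⊥-elim (∼⇒≢ y∼z (≡.sym p))
    ... | no _  | no _  | yes p = ⊥-elim (no-triangle y∼z (∼-sym p))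
    ... | no _  | no _  | no _  = ≡.refl

    -- The unit ball of `x`, split by the value of `potential`: 2 at `x`, 1 at `y`, 3 at the other
    -- neighbours. For `NearY` the values are 1 at `y`, 2 at `x` and 0 at the other neighbours.
    data NearX (z : V) : Set where
      centre : z ≡ x → NearX z
      across : z ≡ y → NearX z
      far    : x ∼ z → z ≢ y → NearX z

    data NearY (z : V) : Set where
      centre : z ≡ y → NearY z
      across : z ≡ x → NearY z
      far    : y ∼ z → z ≢ x → NearY z

    -- Formulated for an arbitrary walk rather than for the distance, so that matching on its first
    -- edges rules out the walks that are too short: they contradict distinctness of vertices or
    -- close a short cycle through the edge.
    potential-lipschitz : ∀ {z z′ k} → NearX z → NearY z′ → Walk G z z′ k →
                          potential z ℕ.≤ k ℕ.+ potential z′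
    potential-lipschitz (centre ≡.refl) (centre ≡.refl) w rewrite potential-x | potential-y = go w
      where
      go : ∀ {k} → Walk G x y k → 2 ℕ.≤ k ℕ.+ 1
      go nil = ⊥-elim (∼-irrefl x∼y)
      go (cons {n = n} _ _) = s≤s (ℕₚ.m≤n+m 1 n)
    potential-lipschitz {k = k} (centre ≡.refl) (across ≡.refl) _ = ℕₚ.m≤n+m _ k
    potential-lipschitz (centre ≡.refl) (far y∼z′ z′≢x) w
      rewrite potential-x | potential-near-y y∼z′ z′≢x = go w
      where
      go : ∀ {k} → Walk G x _ k → 2 ℕ.≤ k ℕ.+ 0
      go nil                   = ⊥-elim (z′≢x ≡.refl)
      go (cons p nil)          = ⊥-elim (no-triangle y∼z′ (∼-sym p))
      go (cons _ (cons _ _))   = s≤s (s≤s z≤n)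
    potential-lipschitz {k = k} (across ≡.refl) (centre ≡.refl) _ = ℕₚ.m≤n+m _ k
    potential-lipschitz {k = k} (across ≡.refl) (across ≡.refl) _
      rewrite potential-x | potential-y = ℕₚ.≤-trans (s≤s z≤n) (ℕₚ.m≤n+m 2 k)
    potential-lipschitz (across ≡.refl) (far y∼z′ z′≢x) w
      rewrite potential-y | potential-near-y y∼z′ z′≢x = go w
      where
      go : ∀ {k} → Walk G y _ k → 1 ℕ.≤ k ℕ.+ 0
      go nil        = ⊥-elim (∼-irrefl y∼z′)
      go (cons _ _) = s≤s z≤n
    potential-lipschitz (far x∼z z≢y) (centre ≡.refl) w
      rewrite potential-y | potential-near-x x∼z z≢y = go w
      where
      go : ∀ {k} → Walk G _ y k → 3 ℕ.≤ k ℕ.+ 1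
      go nil                           = ⊥-elim (z≢y ≡.refl)
      go (cons p nil)                  = ⊥-elim (no-triangle (∼-sym p) (∼-sym x∼z))
      go (cons _ (cons {n = n} _ _))   = s≤s (s≤s (ℕₚ.m≤n+m 1 n))
    potential-lipschitz (far x∼z z≢y) (across ≡.refl) w
      rewrite potential-x | potential-near-x x∼z z≢y = go w
      where
      go : ∀ {k} → Walk G _ x k → 3 ℕ.≤ k ℕ.+ 2
      go nil                = ⊥-elim (∼-irrefl x∼z)
      go (cons {n = n} _ _) = s≤s (ℕₚ.m≤n+m 2 n)
    potential-lipschitz (far x∼z z≢y) (far y∼z′ z′≢x) w
      rewrite potential-near-x x∼z z≢y | potential-near-y y∼z′ z′≢x = go w
      where
      go : ∀ {k} → Walk G _ _ k → 3 ℕ.≤ k ℕ.+ 0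
      -- Walks of length 0, 1 and 2 between outer neighbours would close a cycle of length 3, 4 and
      -- 5 through the edge; this case uses all three exclusions.
      go nil                            = ⊥-elim (no-triangle y∼z′ (∼-sym x∼z))
      go (cons p nil)                   = ⊥-elim (no-square y∼z′ (∼-sym p) (∼-sym x∼z) z′≢x z≢y)
      go (cons p (cons q nil))          =
        ⊥-elim (no-pentagon y∼z′ (∼-sym q) (∼-sym p) (∼-sym x∼z) z′≢x z≢y)
      go (cons _ (cons _ (cons _ _)))   = s≤s (s≤s (s≤s z≤n))

-- Curvature of a tree-like edge

module CurvatureBounds
  (em : ExcludedMiddle 0ℓ) (ℝ : CompleteOrderedField)
  (G : SimpleGraph) (locallyFinite : LocallyFinite G) (connected : Connected G)
  where

  open SimpleGraph G
  open CompleteOrderedField ℝ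
  open FieldLemmas ℝ
  open OrderedField ℝ
  open Curvature em ℝ G locallyFinite connected
  open ShortCycles em G using (module TreeLikeEdge)
  open NaturalCoefficients commutativeSemiring using (solve; _:+_; _:*_; _:=_; con; Polynomial)
  open Probability using (mass; support)

  shortestWalk : ∀ x y → Walk G x y (d x y)
  shortestWalk x y = let n , p = connected x y in proj₁ (proj₂ (leastℕ (Walk G x y) n p))

  ∈⇒∼ : ∀ {x z} → z ∈ neighbours x → x ∼ z
  ∈⇒∼ {x} {z} = Equivalence.to (proj₂ (proj₂ (locallyFinite x)) z)

  ∼⇒∈ : ∀ {x z} → x ∼ z → z ∈ neighbours x
  ∼⇒∈ {x} {z} = Equivalence.from (proj₂ (proj₂ (locallyFinite x)) z)

  neighbours-unique : ∀ x → Unique (neighbours x)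
  neighbours-unique x = proj₁ (proj₂ (locallyFinite x))

  -- The easy half of Kantorovich duality.

  expectation : Probability → (V → ℕ) → Carrier
  expectation μ f = ∑[ z ∈ support μ ] (fromℕ (f z) * mass μ z)

  module _ (μ ν : Probability) (f : V → ℕ)
           (lipschitz : ∀ z z′ → z ∈ support μ → z′ ∈ support ν → f z ℕ.≤ d z z′ ℕ.+ f z′)
    where

    -- Both expectations become double sums against the plan through its marginals, and the
    -- Lipschitz bound is applied to each pair. Keeping `expectation ν f` on the right avoids
    -- subtraction.
    expectation≤cost : (π : Coupling μ ν) →
                       expectation μ f ≤ Coupling.cost π + expectation ν f
    expectation≤cost π = begin
      (∑[ z ∈ X ] (fromℕ (f z) * mass μ z))
        ≈⟨ ∑-cong X (λ z _ → trans (*-congˡ (sym (marginalˡ z))) (sym (∑-*ˡ _ Y _))) ⟩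
      (∑[ z ∈ X ] ∑[ z′ ∈ Y ] (fromℕ (f z) * plan z z′))
        ≤⟨ ∑-mono X (λ z z∈ → ∑-mono Y λ z′ z′∈ → pointwise z z′ z∈ z′∈) ⟩
      (∑[ z ∈ X ] ∑[ z′ ∈ Y ] (fromℕ (d z z′) * plan z z′ + fromℕ (f z′) * plan z z′))
        ≈⟨ ∑-cong X (λ z _ → ∑-+ Y _ _) ⟩
      (∑[ z ∈ X ] ((∑[ z′ ∈ Y ] (fromℕ (d z z′) * plan z z′)) + (∑[ z′ ∈ Y ] (fromℕ (f z′) * plan z z′))))
        ≈⟨ ∑-+ X _ _ ⟩
      cost + (∑[ z ∈ X ] ∑[ z′ ∈ Y ] (fromℕ (f z′) * plan z z′))
        ≈⟨ +-congˡ (∑-swap X Y _) ⟩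
      cost + (∑[ z′ ∈ Y ] ∑[ z ∈ X ] (fromℕ (f z′) * plan z z′))
        ≈⟨ +-congˡ (∑-cong Y λ z′ _ → trans (∑-*ˡ _ X _) (*-congˡ (marginalʳ z′))) ⟩
      cost + expectation ν f
        ∎
      where
      open ≤-Reasoning
      open Coupling π
      X = support μ
      Y = support ν
      pointwise : ∀ z z′ → z ∈ X → z′ ∈ Y →
        fromℕ (f z) * plan z z′ ≤ fromℕ (d z z′) * plan z z′ + fromℕ (f z′) * plan z z′
      pointwise z z′ z∈ z′∈ = ≤-resp₂ refl
        (trans (*-congʳ (fromℕ-+ (d z z′) (f z′))) (distribʳ _ _ _))
        (*-monoˡ-≤ (nonneg z z′) (fromℕ-mono-≤ (lipschitz z z′ z∈ z′∈)))

    -- The difference of the expectations is a lower bound for the cost of every coupling, hence for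
    -- the infimum.
    expectation≤W₁ : expectation μ f ≤ W₁ μ ν + expectation ν f
    expectation≤W₁ = ≤-resp₂ (x-y+y≈x _ _) refl (+-monoˡ-≤ (expectation ν f)
      (proj₂ (proj₂ (W₁-infimum μ ν)) (expectation μ f - expectation ν f)
        λ r (π , cost≈r) → +-cancelʳ-≤ (expectation ν f)
          (≤-resp₂ (sym (x-y+y≈x _ _)) (+-congʳ cost≈r) (expectation≤cost π))))

  -- Transition ratios and the curvature bound.

  module _ (w : Weight) where
    open Weight w

    -- The transition probability of the random walk with conductances `w`; multiplied by `1# - α`
    -- it is the mass that the measure at `x` gives to the neighbour `y`.
    ratio : V → V → Carrier
    ratio x y = weight x y * degree w x ⁻¹

    ratio-positive : ∀ {x y} → x ∼ y → 0# < ratio x y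
    ratio-positive x∼y = *-positive (positive x∼y) (⁻¹-positive (degree-positive w x∼y))

    ∑-ratio : ∀ {x y} → x ∼ y → ∑ (neighbours x) (ratio x) ≈ 1#
    ∑-ratio {x} x∼y = trans (∑-cong (neighbours x) λ _ _ → *-comm _ _)
      (trans (∑-*ˡ _ (neighbours x) (weight x)) (trans (*-comm _ _)
        (*-inverseʳ _ (proj₂ (degree-positive w x∼y) ∘ sym))))

    ∑-ratio≤1 : ∀ {x y} → x ∼ y → (zs : List V) → Unique zs → All (x ∼_) zs →
                ∑ zs (ratio x) ≤ 1#
    ∑-ratio≤1 x∼y zs u zs∼ = ≤-resp₂ refl (∑-ratio x∼y)
      (∑-⊆ zs u (∼⇒∈ ∘ All.lookup zs∼) (All.tabulate (proj₁ ∘ ratio-positive ∘ ∈⇒∼)))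

    mass-centre : ∀ α x → μ-mass w α x x ≈ α
    mass-centre α x with em {x ≡ x} | em {x ∼ x}
    ... | yes _ | _ = refl
    ... | no ¬p | _ = ⊥-elim (¬p ≡.refl)

    mass-neighbour : ∀ α {x z} → x ∼ z → μ-mass w α x z ≈ (1# - α) * ratio x z
    mass-neighbour α {x} {z} x∼z with em {z ≡ x} | em {x ∼ z}
    ... | yes ≡.refl | _     = ⊥-elim (∼-irrefl x∼z)
    ... | no _       | yes _ = refl
    ... | no _       | no ¬p = ⊥-elim (¬p x∼z)

    module _ {α} (0≤α : 0# ≤ α) (α≤1 : α ≤ 1#) where

      -- Replacing `f` by `k` on all neighbours changes only the term at `y`, and the masses of the
      -- neighbours add up to `1# - α`. For `potential` the constant is 3 around `x` and 0 around
      -- `y`.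
      expectation-μ : ∀ {x y} (x∼y : x ∼ y) (f : V → ℕ) k →
        (∀ z → x ∼ z → z ≢ y → f z ≡ k) →
        expectation (μ w 0≤α α≤1 x∼y) f + fromℕ k * ((1# - α) * ratio x y)
          ≈ fromℕ (f x) * α + fromℕ k * (1# - α) + fromℕ (f y) * ((1# - α) * ratio x y)
      expectation-μ {x} {y} x∼y f k f≡k = begin
        F x * m x + S + K * (b * ratio x y)
          ≈⟨ +-assoc _ _ _ ⟩
        F x * m x + (S + K * (b * ratio x y))
          ≈⟨ +-cong (*-congˡ (mass-centre α x)) (+-congˡ (*-congˡ (sym m-y))) ⟩
        F x * α + (S + K * m y)
          ≈⟨ +-congˡ (∑-update (neighbours-unique x) (∼⇒∈ x∼y) λ z z∈ z≢y →
               *-congʳ (reflexive (≡.cong fromℕ (f≡k z (∈⇒∼ z∈) z≢y)))) ⟩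
        F x * α + ((∑[ z ∈ neighbours x ] (K * m z)) + F y * m y)
          ≈⟨ +-congˡ (+-cong (trans (∑-*ˡ K (neighbours x) m) (*-congˡ ∑m≈b)) (*-congˡ m-y)) ⟩
        F x * α + (K * b + F y * (b * ratio x y))
          ≈⟨ +-assoc _ _ _ ⟨
        F x * α + K * b + F y * (b * ratio x y) ∎
        where
        open SetoidReasoning setoid
        F = fromℕ ∘ f
        K = fromℕ k
        b = 1# - α
        m = μ-mass w α x
        S = ∑[ z ∈ neighbours x ] (F z * m z)
        m-y = mass-neighbour α x∼y
        ∑m≈b : ∑ (neighbours x) m ≈ b
        ∑m≈b = trans (∑-cong (neighbours x) λ z → mass-neighbour α ∘ ∈⇒∼)
          (trans (∑-*ˡ b (neighbours x) (ratio x)) (trans (*-congˡ (∑-ratio x∼y)) (*-identityʳ b)))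

    module _ {x y} (x∼y : x ∼ y) (treeLike : TreeLike G x y) where
      open TreeLikeEdge x∼y treeLike

      excess : Carrier
      excess = fromℕ 2 * (ratio x y + ratio y x) - fromℕ 2

      -- With b = 1 - α, s = r(x,y) and t = r(y,x), the potential has expectations 2α + 3b - 2bs and
      -- α + 2bt. By duality W₁ is at least their difference, so κ is at most 1 - α - 3b + 2b(s +
      -- t), which is b(2(s + t) - 2).
      κ≤excess : ∀ {α} (0≤α : 0# ≤ α) (α≤1 : α ≤ 1#) →
                 κ w 0≤α α≤1 x∼y ≤ (1# - α) * excess
      κ≤excess {α} 0≤α α≤1 = +-cancelʳ-≤ Z (begin
          k + Z
            ≈⟨ +-congˡ (solve 3 (λ a b c → (two :* b :+ two :* a :+ b :+ c)
                 := (two :* a :+ three :* b :+ one :* c)) refl α b (b * s)) ⟩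
          k + (fromℕ 2 * α + fromℕ 3 * b + fromℕ 1 * (b * s))
            ≈⟨ +-congˡ Ex-value ⟨
          k + (Ex + fromℕ 3 * (b * s))
            ≤⟨ +-mono-≤ ≤.refl (+-monoˡ-≤ _ Ex≤W+Ey) ⟩
          k + (W + Ey + fromℕ 3 * (b * s))
            ≈⟨ solve 4 (λ k w e c → k :+ (w :+ e :+ c) := k :+ w :+ e :+ c) refl _ _ _ _ ⟩
          k + W + Ey + fromℕ 3 * (b * s)
            ≈⟨ +-congʳ (+-cong (x-y+y≈x 1# W) Ey-value) ⟩
          1# + (α + fromℕ 2 * (b * t)) + fromℕ 3 * (b * s)
            ≈⟨ +-congʳ (+-congʳ (x-y+y≈x 1# α)) ⟨
          b + α + (α + fromℕ 2 * (b * t)) + fromℕ 3 * (b * s)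
            ≈⟨ solve 4 (λ a b s t →
                 b :+ a :+ (a :+ two :* (b :* t)) :+ three :* (b :* s)
                 := b :* (two :* (s :+ t)) :+ (two :* a :+ b :+ b :* s)) refl α b s t ⟩
          b * (fromℕ 2 * (s + t)) + (fromℕ 2 * α + b + b * s)
            ≈⟨ +-congʳ (*-congˡ (x-y+y≈x _ (fromℕ 2))) ⟨
          b * (excess + fromℕ 2) + (fromℕ 2 * α + b + b * s)
            ≈⟨ solve 4 (λ a b e c → b :* (e :+ two) :+ (two :* a :+ b :+ c)
                 := b :* e :+ (two :* b :+ two :* a :+ b :+ c)) refl α b excess (b * s) ⟩
          b * excess + Z ∎)
        where
        open ≤-Reasoning
        μx = μ w 0≤α α≤1 x∼y
        μy = μ w 0≤α α≤1 (∼-sym x∼y)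
        one two three : ∀ {n} → Polynomial n
        one   = con 1 :+ con 0
        two   = con 1 :+ one
        three = con 1 :+ two
        b = 1# - α
        s = ratio x y
        t = ratio y x
        k = κ w 0≤α α≤1 x∼y
        W = W₁ μx μy
        Ex = expectation μx potential
        Ey = expectation μy potential
        -- This is the right-hand side of `Ex-value`, regrouped to show the `fromℕ 2 * b` that
        -- clears the subtraction in `excess`. Adding it to both sides leaves only semiring
        -- identities, with `b` as an atom.
        Z = fromℕ 2 * b + fromℕ 2 * α + b + b * s

        nearX : ∀ {z} → z ∈ x ∷ neighbours x → NearX z
        nearX (here p) = centre p
        nearX {z} (there z∈) with em {z ≡ y}
        ... | yes p  = across p
        ... | no z≢y = far (∈⇒∼ z∈) z≢y

        nearY : ∀ {z} → z ∈ y ∷ neighbours y → NearY z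
        nearY (here p) = centre p
        nearY {z} (there z∈) with em {z ≡ x}
        ... | yes p  = across p
        ... | no z≢x = far (∈⇒∼ z∈) z≢x

        Ex≤W+Ey : Ex ≤ W + Ey
        Ex≤W+Ey = expectation≤W₁ μx μy potential λ z z′ z∈ z′∈ →
          potential-lipschitz (nearX z∈) (nearY z′∈) (shortestWalk z z′)

        Ex-value : Ex + fromℕ 3 * (b * s) ≈ fromℕ 2 * α + fromℕ 3 * b + fromℕ 1 * (b * s)
        Ex-value = trans (expectation-μ 0≤α α≤1 x∼y potential 3 λ _ → potential-near-x)
          (+-cong (+-congʳ (*-congʳ (reflexive (≡.cong fromℕ potential-x))))
            (*-congʳ (reflexive (≡.cong fromℕ potential-y))))

        Ey-value : Ey ≈ α + fromℕ 2 * (b * t)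
        Ey-value = begin-equality
          Ey
            -- The outer neighbours of `y` have potential 0, so the correction term of
            -- `expectation-μ` can be inserted for free.
            ≈⟨ solve 2 (λ e c → e := e :+ con 0 :* c) refl Ey (b * t) ⟩
          Ey + fromℕ 0 * (b * t)
            ≈⟨ expectation-μ 0≤α α≤1 (∼-sym x∼y) potential 0 (λ _ → potential-near-y) ⟩
          fromℕ (potential y) * α + fromℕ 0 * b + fromℕ (potential x) * (b * t)
            ≈⟨ +-cong (+-congʳ (*-congʳ (reflexive (≡.cong fromℕ potential-y))))
                 (*-congʳ (reflexive (≡.cong fromℕ potential-x))) ⟩
          fromℕ 1 * α + fromℕ 0 * b + fromℕ 2 * (b * t)
            ≈⟨ solve 3 (λ a b c → one :* a :+ con 0 :* b :+ c := a :+ c) refl α b _ ⟩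
          α + fromℕ 2 * (b * t) ∎

      -- The quotients are at most `excess` for every α below 1. A limit `L` above `excess` would,
      -- with tolerance `L - excess`, force some quotient strictly above it.
      κLLY≤excess : ∀ {L} → IsκLLY w x∼y L → L ≤ excess
      κLLY≤excess {L} isκ with ≤.total L excess | em {L ≈ excess}
      ... | inj₁ L≤M | _       = L≤M
      ... | inj₂ _   | yes L≈M = ≤.reflexive L≈M
      ... | inj₂ M≤L | no L≉M  =
        let ε>0 = x<y⇒0<y-x (M≤L , L≉M ∘ sym)
            _ , 0<δ , close = isκ (L - excess) ε>0
            α , 0≤α , α<1 , 1-δ<α = approach-1 0<δ
            L-ε<q , _ = close α 0≤α α<1 1-δ<α
        in ⊥-elim (≤⇒≯ (q≤excess 0≤α α<1) (<-resp₂ L-[L-M]≈M refl L-ε<q))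
        where
        L-[L-M]≈M : L - (L - excess) ≈ excess
        L-[L-M]≈M = begin
          L - (L - excess)                     ≈⟨ +-congʳ (x-y+y≈x L excess) ⟨
          L - excess + excess - (L - excess)   ≈⟨ +-congʳ (+-comm _ _) ⟩
          excess + (L - excess) - (L - excess) ≈⟨ +-assoc _ _ _ ⟩
          excess + (L - excess - (L - excess)) ≈⟨ +-congˡ (-‿inverseʳ _) ⟩
          excess + 0#                          ≈⟨ +-identityʳ _ ⟩
          excess                               ∎
          where open SetoidReasoning setoid
        q≤excess : ∀ {α} (0≤α : 0# ≤ α) (α<1 : α < 1#) →
                   κ w 0≤α (proj₁ α<1) x∼y * (1# - α) ⁻¹ ≤ excess
        q≤excess {α} 0≤α α<1 = begin
          κ w 0≤α (proj₁ α<1) x∼y * b ⁻¹  ≤⟨ *-monoˡ-≤ (proj₁ (⁻¹-positive b>0)) (κ≤excess 0≤α (proj₁ α<1)) ⟩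
          b * excess * b ⁻¹               ≈⟨ *-congʳ (*-comm b excess) ⟩
          excess * b * b ⁻¹               ≈⟨ *-assoc _ _ _ ⟩
          excess * (b * b ⁻¹)             ≈⟨ *-congˡ (*-inverseʳ b (proj₂ b>0 ∘ sym)) ⟩
          excess * 1#                     ≈⟨ *-identityʳ _ ⟩
          excess                          ∎
          where
          open ≤-Reasoning
          b = 1# - α
          b>0 = x<y⇒0<y-x α<1

      1≤ratios : Admissible w → 1# ≤ ratio x y + ratio y x
      1≤ratios admissible with ≤.total 1# (ratio x y + ratio y x)
      ... | inj₁ p = p
      -- In the case r ≤ 1 the chain 2 ≤ r + r ≤ r + 1 gives 1 ≤ r after cancelling 1, with no
      -- division by 2.
      ... | inj₂ q = +-cancelʳ-≤ 1# (begin
          1# + 1#                 ≈⟨ solve 0 (con 1 :+ con 1 := con 0 :+ two) refl ⟩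
          0# + fromℕ 2            ≤⟨ +-monoˡ-≤ (fromℕ 2) 0≤excess ⟩
          excess + fromℕ 2        ≈⟨ x-y+y≈x _ _ ⟩
          fromℕ 2 * r             ≈⟨ solve 1 (λ r → two :* r := r :+ r) refl r ⟩
          r + r                   ≤⟨ +-mono-≤ ≤.refl q ⟩
          r + 1#                  ∎)
        where
        open ≤-Reasoning
        r = ratio x y + ratio y x
        two : ∀ {n} → Polynomial n
        two = con 1 :+ (con 1 :+ con 0)
        0≤excess : 0# ≤ excess
        0≤excess = let _ , isκ , 0≤L = admissible x∼y in ≤.trans 0≤L (κLLY≤excess isκ)

-- Cycles of tree-like edges

module _ (m : ℕ) where

  private n = suc m

  toℕ-mod : ∀ i → toℕ (i mod n) ≡ i % n
  toℕ-mod i = toℕ-fromℕ< (m%n<n i n)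

  suc-% : ∀ i → suc i % n ≡ suc (i % n) % n
  suc-% i = begin
    (1 ℕ.+ i) % n               ≡⟨ %-distribˡ-+ 1 i n ⟩
    (1 % n ℕ.+ i % n) % n       ≡⟨ ≡.cong (λ r → (1 % n ℕ.+ r) % n) (m%n%n≡m%n i n) ⟨
    (1 % n ℕ.+ i % n % n) % n   ≡⟨ %-distribˡ-+ 1 (i % n) n ⟨
    (1 ℕ.+ i % n) % n           ∎
    where open ≡.≡-Reasoning

  -- Either the residue of `i` grows by one, or it is the last one and the next residue wraps around
  -- to 0.
  successor-mod : ∀ i → CyclicSuccessor (i mod n) (suc i mod n)
  successor-mod i with ℕₚ.m≤n⇒m<n∨m≡n (m%n<n i n)
  ... | inj₁ 1+i%n<n = inj₁ (≡.trans (≡.cong suc (toℕ-mod i))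
          (≡.sym (≡.trans (toℕ-mod (suc i)) (≡.trans (suc-% i) (m<n⇒m%n≡m 1+i%n<n)))))
  ... | inj₂ 1+i%n≡n = inj₂
          ( ≡.trans (≡.cong suc (toℕ-mod i)) 1+i%n≡n
          , ≡.trans (toℕ-mod (suc i))
              (≡.trans (suc-% i) (≡.trans (≡.cong (_% n) 1+i%n≡n) (n%n≡0 n))) )

  mod-periodic : ∀ i → (i ℕ.+ n) mod n ≡ i mod n
  mod-periodic i = toℕ-injective
    (≡.trans (toℕ-mod (i ℕ.+ n)) (≡.trans ([m+n]%n≡m%n i n) (≡.sym (toℕ-mod i))))

  toℕ-mod-inverse : ∀ (k : Fin n) → toℕ k mod n ≡ k
  toℕ-mod-inverse k = toℕ-injective (≡.trans (toℕ-mod (toℕ k)) (m<n⇒m%n≡m (toℕ<n k)))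

-- Returning after two cyclic steps is possible only for length at most 2.
two-step-≢ : ∀ {n} {i j k : Fin n} → 3 ℕ.≤ n → CyclicSuccessor i j → CyclicSuccessor j k → i ≢ k
two-step-≢ 3≤n p q ≡.refl = go 3≤n p q
  where
  go : ∀ {n a b} → 3 ℕ.≤ n → suc a ≡ b ⊎ (suc a ≡ n × b ≡ 0) →
       suc b ≡ a ⊎ (suc b ≡ n × a ≡ 0) → ⊥
  go _ (inj₁ ≡.refl) (inj₁ ())
  go (s≤s (s≤s ())) (inj₁ ≡.refl) (inj₂ (≡.refl , ≡.refl))
  go (s≤s (s≤s ())) (inj₂ (≡.refl , ≡.refl)) (inj₁ ≡.refl)

-- Rigidity: a cycle of tree-like edges fills the graph.

module Rigidity
  (em : ExcludedMiddle 0ℓ) (ℝ : CompleteOrderedField)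
  (G : SimpleGraph) (locallyFinite : LocallyFinite G) (connected : Connected G)
  (w : Curvature.Weight em ℝ G locallyFinite connected)
  (admissible : Curvature.Admissible em ℝ G locallyFinite connected w)
  {m : ℕ} (cycle : Cycle (𝒮 G) (suc m))
  where

  open SimpleGraph G
  open CompleteOrderedField ℝ hiding (zero)
  open FieldLemmas ℝ
  open OrderedField ℝ
  open CurvatureBounds em ℝ G locallyFinite connected
  open Cycle cycle

  n = suc m

  -- The cycle is unrolled into a periodic sequence over the naturals, so that monotonicity along it
  -- makes sense and can be proved by induction.
  u : ℕ → V
  u i = vertex (i mod n)

  edge : ∀ i → SimpleGraph._∼_ (𝒮 G) (u i) (u (suc i))
  edge i = adjacent (inj₁ (successor-mod m i))

  u∼ : ∀ i → u i ∼ u (suc i)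
  u∼ i = proj₁ (edge i)

  u-two-step-≢ : ∀ i → u i ≢ u (suc (suc i))
  u-two-step-≢ i e = two-step-≢ 3≤n (successor-mod m i) (successor-mod m (suc i)) (injective e)

  forward backward : ℕ → Carrier
  forward  i = ratio w (u i) (u (suc i))
  backward i = ratio w (u (suc i)) (u i)

  1≤forward+backward : ∀ i → 1# ≤ forward i + backward i
  1≤forward+backward i = 1≤ratios w (u∼ i) (proj₂ (edge i)) admissible

  -- Both ratios are based at `u (suc i)` and point to its two distinct neighbours on the cycle.
  forward+backward≤1 : ∀ i → forward (suc i) + backward i ≤ 1#
  forward+backward≤1 i = ≤-resp₂ (+-congˡ (+-identityʳ _)) refl
    (∑-ratio≤1 w (u∼ (suc i)) (u (suc (suc i)) ∷ u i ∷ [])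
      ((u-two-step-≢ i ∘ ≡.sym ∷ []) ∷ [] ∷ []) (u∼ (suc i) ∷ ∼-sym (u∼ i) ∷ []))

  forward-step : ∀ i → forward (suc i) ≤ forward i
  forward-step i = +-cancelʳ-≤ (backward i) (≤.trans (forward+backward≤1 i) (1≤forward+backward i))

  forward-antitone : ∀ k i → forward (k ℕ.+ i) ≤ forward i
  forward-antitone zero    i = ≤.refl
  forward-antitone (suc k) i = ≤.trans (forward-step (k ℕ.+ i)) (forward-antitone k i)

  -- Going once around the cycle, the antitone sequence returns to its start.
  forward-constant : ∀ i → forward i ≤ forward (suc i)
  forward-constant i = ≤-resp₂ (reflexive period) refl (forward-antitone m (suc i))
    where
    m+1+i≡i+n : m ℕ.+ suc i ≡ i ℕ.+ n
    m+1+i≡i+n = ≡.trans (ℕₚ.+-suc m i) (ℕₚ.+-comm n i)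
    period : forward (m ℕ.+ suc i) ≡ forward i
    period = ≡.trans (≡.cong forward m+1+i≡i+n)
      (≡.cong₂ (λ j k → ratio w (vertex j) (vertex k)) (mod-periodic m i) (mod-periodic m (suc i)))

  -- Since `forward` is constant, the ratios towards the two cycle neighbours already add up to at
  -- least 1, whereas a third neighbour would contribute a positive ratio to a sum bounded by 1.
  u-neighbours : ∀ i {z} → u (suc i) ∼ z → z ≡ u i ⊎ z ≡ u (suc (suc i))
  u-neighbours i {z} u∼z with em {z ≡ u i} | em {z ≡ u (suc (suc i))}
  ... | yes p | _     = inj₁ p
  ... | no _  | yes p = inj₂ p
  ... | no z≢ | no z≢′ = ⊥-elim (≤⇒≯ third≤0 (ratio-positive w u∼z))
    where
    three≤1 : forward (suc i) + (backward i + (ratio w (u (suc i)) z + 0#)) ≤ 1#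
    three≤1 = ∑-ratio≤1 w (u∼ (suc i)) (u (suc (suc i)) ∷ u i ∷ z ∷ [])
      ((u-two-step-≢ i ∘ ≡.sym ∷ z≢′ ∘ ≡.sym ∷ []) ∷ (z≢ ∘ ≡.sym ∷ []) ∷ [] ∷ [])
      (u∼ (suc i) ∷ ∼-sym (u∼ i) ∷ u∼z ∷ [])
    third≤0 : ratio w (u (suc i)) z ≤ 0#
    third≤0 = +-cancelʳ-≤ (forward (suc i) + backward i) (begin
      ratio w (u (suc i)) z + (forward (suc i) + backward i)          ≈⟨ +-comm _ _ ⟩
      forward (suc i) + backward i + ratio w (u (suc i)) z            ≈⟨ +-assoc _ _ _ ⟩
      forward (suc i) + (backward i + ratio w (u (suc i)) z)          ≈⟨ +-congˡ (+-congˡ (+-identityʳ _)) ⟨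
      forward (suc i) + (backward i + (ratio w (u (suc i)) z + 0#))   ≤⟨ three≤1 ⟩
      1#                                                              ≤⟨ 1≤forward+backward i ⟩
      forward i + backward i                                          ≤⟨ +-monoˡ-≤ _ (forward-constant i) ⟩
      forward (suc i) + backward i                                    ≈⟨ +-identityˡ _ ⟨
      0# + (forward (suc i) + backward i)                             ∎)
      where open ≤-Reasoning

  Adj : Fin n → Fin n → Set
  Adj = SimpleGraph._∼_ (C n 3≤n)

  vertex-neighbours : ∀ k {z} → vertex k ∼ z → ∃ λ j → Adj k j × vertex j ≡ z
  vertex-neighbours k {z} k∼z = ≡.subst (λ k → ∃ λ j → Adj k j × vertex j ≡ z) index-k
    (case-split (u-neighbours i (≡.subst (λ k → vertex k ∼ z) (≡.sym index-k) k∼z)))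
    where
    -- Modulo `suc m`, adding `m` is stepping back by one, so `suc i` represents `k`.
    i = toℕ k ℕ.+ m
    index-k : suc i mod n ≡ k
    index-k = ≡.trans (≡.cong (_mod n) (≡.sym (ℕₚ.+-suc (toℕ k) m)))
      (≡.trans (mod-periodic m (toℕ k)) (toℕ-mod-inverse m k))
    case-split : z ≡ u i ⊎ z ≡ u (suc (suc i)) → ∃ λ j → Adj (suc i mod n) j × vertex j ≡ z
    case-split (inj₁ p) = i mod n , inj₂ (successor-mod m i) , ≡.sym p
    case-split (inj₂ p) = suc (suc i) mod n , inj₁ (successor-mod m (suc i)) , ≡.sym p

  -- All neighbours of a cycle vertex lie on the cycle, so a walk starting there never leaves it;
  -- connectedness then makes `vertex` surjective.
  reach : ∀ {l z} k → Walk G (vertex k) z l → ∃ λ j → vertex j ≡ z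
  reach k nil = k , ≡.refl
  reach k (cons k∼z walk) with vertex-neighbours k k∼z
  ... | j , _ , ≡.refl = reach j walk

  vertex-surjective : ∀ z → ∃ λ j → vertex j ≡ z
  vertex-surjective z = reach zero (proj₂ (connected (vertex zero) z))

  -- Surjectivity supplies the inverse of `vertex`. Adjacency in the cyclic graph passes to `G`
  -- because the cycle is a homomorphism; the converse holds because `vertex-neighbours` leaves no
  -- chords.
  G≅C : G ≅ C n 3≤n
  G≅C = mk↔ₛ′ index vertex (λ k → injective (vertex-index (vertex k))) vertex-index ,
        λ x y → mk⇔ to (from x y)
    where
    index : V → Fin n
    index = proj₁ ∘ vertex-surjective
    vertex-index : ∀ z → vertex (index z) ≡ z
    vertex-index = proj₂ ∘ vertex-surjective
    to : ∀ {x y} → x ∼ y → Adj (index x) (index y)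
    to {x} {y} x∼y
      with vertex-neighbours (index x) (≡.subst (_∼ y) (≡.sym (vertex-index x)) x∼y)
    ... | j , adj , eq =
      ≡.subst (Adj (index x)) (injective (≡.trans eq (≡.sym (vertex-index y)))) adj
    from : ∀ x y → Adj (index x) (index y) → x ∼ y
    from x y adj = ≡.subst₂ _∼_ (vertex-index x) (vertex-index y) (proj₁ (adjacent adj))

-- Length of the cycle and the final dichotomy.

successor-exists : ∀ {n} → 3 ℕ.≤ n → ∃₂ λ (i j : Fin n) → CyclicSuccessor i j
successor-exists (s≤s (s≤s _)) = zero , suc zero , inj₁ ≡.refl

cycle⇒edge : ∀ {G n} → Cycle G n → ∃₂ (SimpleGraph._∼_ G)
cycle⇒edge cycle =
  let i , j , s = successor-exists 3≤n in vertex i , vertex j , adjacent (inj₁ s)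
  where open Cycle cycle

-- A cycle of the skeleton is also a cycle of `G`, and it contains its own edges. These are
-- tree-like, so the length cannot be 3, 4 or 5.
6≤length : ∀ {G n} → Cycle (𝒮 G) n → 6 ℕ.≤ n
6≤length {G} {n} cycle =
  ℕₚ.≤∧≢⇒< (ℕₚ.≤∧≢⇒< (ℕₚ.≤∧≢⇒< 3≤n
    (not-short ∘ inj₁ ∘ ≡.sym)) (not-short ∘ inj₂ ∘ inj₁ ∘ ≡.sym)) (not-short ∘ inj₂ ∘ inj₂ ∘ ≡.sym)
  where
  open Cycle cycle
  cycle-in-G : Cycle G n
  cycle-in-G = record
    { 3≤n = 3≤n ; vertex = vertex ; injective = injective ; adjacent = proj₁ ∘ adjacent }
  not-short : ¬ (n ≡ 3 ⊎ n ≡ 4 ⊎ n ≡ 5)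
  not-short n∈ =
    let i , j , s = successor-exists 3≤n
    in proj₂ (adjacent (inj₁ s)) n n∈ cycle-in-G (i , j , inj₁ s , ≡.refl , ≡.refl)

module _
  (em : ExcludedMiddle 0ℓ) (ℝ : CompleteOrderedField)
  (G : SimpleGraph) (locallyFinite : LocallyFinite G) (connected : Connected G)
  where

  open Curvature em ℝ G locallyFinite connected

  -- The case splits repeat those in the definition of `DN-LLY`. Once an edge exists, a finite value
  -- can only be the infimum of a nonempty set, and a member of that set comes with an admissible
  -- weight.
  finite⇒admissible : Finite DN-LLY → HasEdge → Σ Weight Admissible
  finite⇒admissible fin hasEdge with em {HasEdge}
  ... | no ¬e = ⊥-elim (¬e hasEdge)
  ... | yes e with em {∃ (FiniteDistortion e)}
  ...   | yes (_ , w , admissible , _) = w , admissible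
  finite⇒admissible () _ | yes e | no _

open import Data.Nat.Base using (_≤_)
open import Data.Nat.Properties using (≤-trans; m≤m+n)

theorem1p1 : (em : ExcludedMiddle 0ℓ) (ℝ : CompleteOrderedField)
    (G : SimpleGraph) (locallyFinite : LocallyFinite G) (connected : Connected G) →
    let open Curvature em ℝ G locallyFinite connected in
    Finite DN-LLY →
    (∃ λ n → Σ (6 ≤ n) λ 6≤n → G ≅ C n (≤-trans (m≤m+n 3 3) 6≤n)) ⊎ IsForest (𝒮 G)
theorem1p1 em ℝ G locallyFinite connected fin with em {∃ (Cycle (𝒮 G))}
... | no acyclic              = inj₂ λ n cycle → acyclic (n , cycle)
-- `Rigidity` works modulo the cycle length and takes it in the form `suc m`, so length 0 is ruled
-- out first.
... | yes (zero , cycle)      = ⊥-elim (ℕₚ.n≮0 (Cycle.3≤n cycle))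
... | yes (n@(suc _) , cycle) =
  let x , y , x∼y , _ = cycle⇒edge cycle
      w , admissible  = finite⇒admissible em ℝ G locallyFinite connected fin (x , y , x∼y)
  in inj₁ (n , 6≤length cycle , Rigidity.G≅C em ℝ G locallyFinite connected w admissible cycle)
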